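{- For all integers $k \ge 1$ it holds that $S_2(k) \le \mathrm{nM}(k) \le k + 1 + \lfloor \log_2(k) \rfloor$.
   Context: For $k \ge 1$, $S_2(k)$ denotes the smallest integer $n \ge 0$ such that $2^k$ divides $n!$. The non-Mersenne numbers: $\mathrm{nM} : \mathbb{N} \to \mathbb{N}$ (with $\mathbb{N} = \{1,2,\dots\}$) is the strictly increasing enumeration of the natural numbers $\ge 1$ that are not of the form $2^n - 1$ for some $n \in \mathbb{N}$; thus $\mathrm{nM}(1), \mathrm{nM}(2), \dots$ is $2,4,5,6,8,9,10,11,12,13,14,16,17,\dots$. -}

module Defs where

open import Data.Nat using (ℕ; zero; suc; pred; _+_; _*_; _∸_; _^_; _≤_; _<_; z≤n; s≤s; _!; NonZero; _≟_; _≤?_; _<?_)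
open import Data.Nat.Properties
open import Data.Nat.Divisibility using (_∣_; divides; _∣?_; ∣-refl; *-pres-∣; ∣n⇒∣m*n; ∣m+n∣m⇒∣n; ∣1⇒≡1; m∣m*n)
open import Data.Product using (∃; ∃-syntax; _×_; _,_; proj₁; proj₂)
open import Data.Sum using (inj₁; inj₂)
open import Function using (_∘_)
open import Level using (Level)
open import Relation.Binary.PropositionalEquality using (_≡_; refl; sym; trans; cong; subst)
open import Relation.Nullary using (¬_; yes; no; contradiction)
open import Relation.Nullary.Decidable using (¬?; _×-dec_; map′)
open import Relation.Unary using (Pred; Decidable)

private
  variable
    ℓ : Level

IsLeast : Pred ℕ ℓ → Pred ℕ ℓ
IsLeast P n = P n × (∀ m → P m → n ≤ m)

least : {P : Pred ℕ ℓ} → Decidable P → ∀ n → P n → ∃ (IsLeast P)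
least P? zero p = zero , p , λ _ _ → z≤n
least P? (suc n) p with P? zero
... | yes p₀ = zero , p₀ , λ _ _ → z≤n
... | no ¬p₀ with least (P? ∘ suc) n p
...   | m , pₘ , min = suc m , pₘ , λ where
          zero    p₀ → contradiction p₀ ¬p₀
          (suc j) pⱼ → s≤s (min j pⱼ)

2^k∣[k*2]! : ∀ k → 2 ^ k ∣ (k * 2) !
2^k∣[k*2]! zero    = ∣-refl
2^k∣[k*2]! (suc k) =
  *-pres-∣ {2} {suc (suc (k * 2))} (divides (suc k) refl) (∣n⇒∣m*n (suc (k * 2)) {(k * 2) !} (2^k∣[k*2]! k))

leastFactorial : ∀ k → ∃ (IsLeast (λ n → 2 ^ k ∣ n !))
leastFactorial k = least (λ n → 2 ^ k ∣? n !) (k * 2) (2^k∣[k*2]! k)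

S₂ : ℕ → ℕ
S₂ k = proj₁ (leastFactorial k)

S₂-isLeast : ∀ k → IsLeast (λ n → 2 ^ k ∣ n !) (S₂ k)
S₂-isLeast k = proj₂ (leastFactorial k)

-- The truncated subtraction is exact, since 1 ≤ 2 ^ n.
Mersenne : Pred ℕ _
Mersenne m = ∃[ n ] 1 ≤ n × m ≡ 2 ^ n ∸ 1

NonMersenne : Pred ℕ _
NonMersenne m = 1 ≤ m × ¬ Mersenne m

n<2^n : ∀ n → n < 2 ^ n
n<2^n zero    = s≤s z≤n
n<2^n (suc n) = +-mono-≤ (m^n>0 2 n) (≤-trans (n<2^n n) (m≤m+n (2 ^ n) 0))

n≤2^n∸1 : ∀ n → n ≤ 2 ^ n ∸ 1
n≤2^n∸1 n = ∸-monoˡ-≤ 1 (n<2^n n)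

Mersenne? : Decidable Mersenne
Mersenne? m = map′
  (λ (n , _ , q) → n , q)
  (λ (n , 1≤n , eq) → n , s≤s (subst (n ≤_) (sym eq) (n≤2^n∸1 n)) , 1≤n , eq)
  (anyUpTo? (λ n → 1 ≤? n ×-dec m ≟ 2 ^ n ∸ 1) (suc m))

NonMersenne? : Decidable NonMersenne
NonMersenne? m = 1 ≤? m ×-dec ¬? (Mersenne? m)

2*suc-nonMersenne : ∀ n → NonMersenne (2 * suc n)
2*suc-nonMersenne n = s≤s z≤n , ¬mersenne
  where
  ¬mersenne : ¬ Mersenne (2 * suc n)
  ¬mersenne (suc i , _ , eq) = contradiction (∣1⇒≡1 2∣1) λ ()
    where
    2∣sum : 2 ∣ 2 * suc n + 1
    2∣sum = subst (2 ∣_)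
      (sym (trans (cong (_+ 1) eq) (m∸n+n≡m (m^n>0 2 (suc i)))))
      (m∣m*n (2 ^ i))

    2∣1 : 2 ∣ 1
    2∣1 = ∣m+n∣m⇒∣n 2∣sum (m∣m*n (suc n))

firstNonMersenne : ∃ (IsLeast NonMersenne)
firstNonMersenne = least NonMersenne? 2 (2*suc-nonMersenne 0)

nextNonMersenne : ∀ b → ∃ (IsLeast (λ m → b < m × NonMersenne m))
nextNonMersenne b = least (λ m → b <? m ×-dec NonMersenne? m)
  (2 * suc b)
  (m≤m+n (suc b) (suc b + 0) , 2*suc-nonMersenne b)

nonMersenne₀ : ℕ → ℕ
nonMersenne₀ zero    = proj₁ firstNonMersenne
nonMersenne₀ (suc k) = proj₁ (nextNonMersenne (nonMersenne₀ k))

-- Indexed from 1, as nonMersenne₀ is from 0.  That this is the strictly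
-- increasing enumeration of the non-Mersenne numbers is nM-enumerates below.
nM : (k : ℕ) → .{{NonZero k}} → ℕ
nM k = nonMersenne₀ (pred k)

record IsStrictlyIncreasingEnumeration
         (P : Pred ℕ ℓ) (f : (k : ℕ) → .{{NonZero k}} → ℕ) : Set ℓ where
  field
    increasing : ∀ i j .{{_ : NonZero i}} .{{_ : NonZero j}} → i < j → f i < f j
    sound      : ∀ k .{{_ : NonZero k}} → P (f k)
    complete   : ∀ m → P m → ∃[ k ] f (suc k) ≡ m

nonMersenne₀-step : ∀ k → nonMersenne₀ k < nonMersenne₀ (suc k)
nonMersenne₀-step k = proj₁ (proj₁ (proj₂ (nextNonMersenne (nonMersenne₀ k))))

nonMersenne₀-increasing : ∀ {i j} → i < j → nonMersenne₀ i < nonMersenne₀ j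
nonMersenne₀-increasing {i} {suc j} (s≤s i≤j) with m≤n⇒m<n∨m≡n i≤j
... | inj₁ i<j  = <-trans (nonMersenne₀-increasing i<j) (nonMersenne₀-step j)
... | inj₂ refl = nonMersenne₀-step j

nonMersenne₀-sound : ∀ k → NonMersenne (nonMersenne₀ k)
nonMersenne₀-sound zero    = proj₁ (proj₂ firstNonMersenne)
nonMersenne₀-sound (suc k) =
  proj₂ (proj₁ (proj₂ (nextNonMersenne (nonMersenne₀ k))))

k≤nonMersenne₀ : ∀ k → k ≤ nonMersenne₀ k
k≤nonMersenne₀ zero    = z≤n
k≤nonMersenne₀ (suc k) = ≤-trans (s≤s (k≤nonMersenne₀ k)) (nonMersenne₀-step k)

nonMersenne₀-complete : ∀ m → NonMersenne m → ∃[ k ] nonMersenne₀ k ≡ m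
nonMersenne₀-complete m p = below m (k≤nonMersenne₀ m)
  where
  below : ∀ k → m ≤ nonMersenne₀ k → ∃[ j ] nonMersenne₀ j ≡ m
  below zero    m≤f = zero , ≤-antisym (proj₂ (proj₂ firstNonMersenne) m p) m≤f
  below (suc k) m≤f with m ≤? nonMersenne₀ k
  ... | yes m≤fk = below k m≤fk
  ... | no  m≰fk = suc k ,
    ≤-antisym (proj₂ (proj₂ (nextNonMersenne (nonMersenne₀ k))) m (≰⇒> m≰fk , p)) m≤f

nM-enumerates : IsStrictlyIncreasingEnumeration NonMersenne nM
nM-enumerates = record
  { increasing = λ where (suc i) (suc j) (s≤s i<j) → nonMersenne₀-increasing i<j
  ; sound      = λ k → nonMersenne₀-sound (pred k)
  ; complete   = nonMersenne₀-complete
  }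

{-# OPTIONS --safe #-}

-- Write m = nM k with 2 ^ a ≤ m < 2 ^ (a + 1) ∸ 1.  Exactly a Mersenne numbers
-- lie below m, so m = k + a, and 2 a ≤ 2 ^ a gives a ≤ 1 + ⌊log₂ k⌋.  For the
-- other bound, v₂ (m !) ≥ m ∸ a by Legendre's formula: m has a + 1 binary digits,
-- which are not all ones.
module Submission where

open import Defs
open import Data.Fin using (zero; suc)
open import Data.Nat using (ℕ; zero; suc; _+_; _*_; _^_; _∸_; _≤_; _<_; z≤n; s≤s; _!; NonZero)
open import Data.Nat.Divisibility using (_∣_; ∣-refl; ∣-trans; *-pres-∣; ∣n⇒∣m*n; n∣m*n; *-monoʳ-∣; *-monoˡ-∣; *-cancelˡ-∣; module ∣-Reasoning)
open import Data.Nat.DivMod using (_divMod_; result)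
open import Data.Nat.Logarithm using (⌊log₂_⌋; ⌊log₂⌋-mono-≤; ⌊log₂[2*b]⌋≡1+⌊log₂b⌋; ⌊log₂[2^n]⌋≡n)
open import Data.Nat.Properties
open import Data.Nat.Tactic.RingSolver using (solve-∀)
open import Data.Product using (∃-syntax; _×_; _,_; proj₁; proj₂)
open import Data.Sum using (inj₁; inj₂)
open import Level using (Level)
open import Relation.Binary.PropositionalEquality using (_≡_; refl; sym; trans; cong; subst)
open import Relation.Unary using (Pred)

private
  variable
    ℓ : Level
    P : Pred ℕ ℓ
    a m n : ℕ

IsLeast-unique : IsLeast P m → IsLeast P n → m ≡ n
IsLeast-unique (pm , m≤) (pn , n≤) = ≤-antisym (m≤ _ pn) (n≤ _ pm)

^-cancelʳ-< : ∀ b .{{_ : NonZero b}} → b ^ m < b ^ n → m < n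
^-cancelʳ-< b p = ≰⇒> λ n≤m → <⇒≱ p (^-monoʳ-≤ b n≤m)

2*n≤2^n : ∀ n → 2 * n ≤ 2 ^ n
2*n≤2^n zero    = z≤n
2*n≤2^n (suc n) = *-monoʳ-≤ 2 (n<2^n n)

q*2<2^[1+a]⇒q<2^a : ∀ q a → q * 2 < 2 ^ suc a → q < 2 ^ a
q*2<2^[1+a]⇒q<2^a q a p = *-cancelʳ-< 2 q (2 ^ a) (subst (q * 2 <_) (*-comm 2 (2 ^ a)) p)

-- The even factors `2 * 1`, ..., `2 * q` of `(q * 2) !` already multiply to `2 ^ q * q !`.
2^q*q!∣[q*2]! : ∀ q → 2 ^ q * q ! ∣ (q * 2) !
2^q*q!∣[q*2]! zero    = ∣-refl
2^q*q!∣[q*2]! (suc q) = subst (_∣ (suc q * 2) !) (interchange (2 ^ q) (q !) q)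
  (*-pres-∣ {suc q * 2} ∣-refl (∣n⇒∣m*n (suc (q * 2)) (2^q*q!∣[q*2]! q)))
  where
  interchange : ∀ x y q → suc q * 2 * (x * y) ≡ 2 * x * (suc q * y)
  interchange = solve-∀

-- In the lemmas below, 2 ^ m ∣ 2 ^ a * m ! stands for v₂ (m !) ≥ m ∸ a.
∣!-double : ∀ a q → 2 ^ q ∣ 2 ^ a * q ! → 2 ^ (q * 2) ∣ 2 ^ a * (q * 2) !
∣!-double a q p = begin
  2 ^ (q * 2)            ≡⟨ ^-*-assoc 2 q 2 ⟨
  (2 ^ q) ^ 2            ≡⟨ cong (2 ^ q *_) (*-identityʳ (2 ^ q)) ⟩
  2 ^ q * 2 ^ q          ∣⟨ *-monoʳ-∣ (2 ^ q) p ⟩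
  2 ^ q * (2 ^ a * q !)  ≡⟨ swap (2 ^ q) (2 ^ a) (q !) ⟩
  2 ^ a * (2 ^ q * q !)  ∣⟨ *-monoʳ-∣ (2 ^ a) (2^q*q!∣[q*2]! q) ⟩
  2 ^ a * (q * 2) !      ∎
  where
  open ∣-Reasoning
  swap : ∀ x y z → x * (y * z) ≡ y * (x * z)
  swap = solve-∀

-- Since `a` grows along with `m`, the new factor `suc m` need not contribute any 2; this handles a
-- last binary digit 1.
∣!-suc : ∀ a m → 2 ^ m ∣ 2 ^ a * m ! → 2 ^ suc m ∣ 2 ^ suc a * suc m !
∣!-suc a m p = begin
  2 ^ suc m            ∣⟨ *-monoʳ-∣ 2 p ⟩
  2 * (2 ^ a * m !)    ≡⟨ *-assoc 2 (2 ^ a) (m !) ⟨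
  2 ^ suc a * m !      ∣⟨ *-monoʳ-∣ (2 ^ suc a) (n∣m*n (suc m)) ⟩
  2 ^ suc a * suc m !  ∎
  where open ∣-Reasoning

-- The deficit of v₂ (m !) from m is the number of ones among at most `a` binary digits. The
-- induction strips the last digit: a 0 costs nothing, a 1 costs one factor 2.
m<2^a⇒2^m∣2^a*m! : ∀ a m → m < 2 ^ a → 2 ^ m ∣ 2 ^ a * m !
m<2^a⇒2^m∣2^a*m! zero    zero p = ∣-refl
m<2^a⇒2^m∣2^a*m! zero    (suc m) (s≤s ())
m<2^a⇒2^m∣2^a*m! (suc a) m p with m divMod 2
... | result q zero refl =
  -- With last digit 0 the divisibility holds with `2 ^ a` already, so one factor 2 is given away.
  ∣-trans (∣!-double a q (m<2^a⇒2^m∣2^a*m! a q (q*2<2^[1+a]⇒q<2^a q a p)))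
          (*-monoˡ-∣ ((q * 2) !) (n∣m*n 2 {2 ^ a}))
... | result q (suc zero) refl =
  ∣!-suc a (q * 2)
    (∣!-double a q (m<2^a⇒2^m∣2^a*m! a q (q*2<2^[1+a]⇒q<2^a q a (<⇒≤ p))))

-- One of the `suc a` digits is 0, which saves a factor 2. Trailing ones are stripped until that 0
-- is last; the previous lemma does the rest.
1+m<2^[1+a]⇒2^m∣2^a*m! : ∀ a m → suc m < 2 ^ suc a → 2 ^ m ∣ 2 ^ a * m !
1+m<2^[1+a]⇒2^m∣2^a*m! a m p with m divMod 2
... | result q zero refl =
  ∣!-double a q (m<2^a⇒2^m∣2^a*m! a q (q*2<2^[1+a]⇒q<2^a q a (<⇒≤ p)))
1+m<2^[1+a]⇒2^m∣2^a*m! zero    m (s≤s (s≤s ())) | result q (suc zero) refl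
-- Here `suc m` is `suc q * 2`, so halving shows that `q` is not all ones either.
1+m<2^[1+a]⇒2^m∣2^a*m! (suc a) m p | result q (suc zero) refl =
  ∣!-suc a (q * 2)
    (∣!-double a q (1+m<2^[1+a]⇒2^m∣2^a*m! a q (q*2<2^[1+a]⇒q<2^a (suc q) (suc a) p)))

-- If `suc m` were `2 ^ n`, then `a < n < suc a`.
between⇒nonMersenne : 2 ^ a ≤ m → suc m < 2 ^ suc a → NonMersenne m
between⇒nonMersenne {a} {m} lo hi = ≤-trans (m^n>0 2 a) lo , λ where
  (n , _ , refl) → let 1+m≡2^n = suc-pred (2 ^ n) {{m^n≢0 2 n}} in
    <⇒≱ (^-cancelʳ-< {a} {n} 2 (subst (2 ^ a <_) 1+m≡2^n (s≤s lo)))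
        (≤-pred (^-cancelʳ-< {n} {suc a} 2 (subst (_< 2 ^ suc a) 1+m≡2^n hi)))

-- Induction along the enumeration, with `a` increasing by one exactly when a Mersenne number is
-- skipped.
nonMersenne₀-position : ∀ j → let m = nonMersenne₀ j in
  ∃[ a ] 2 ^ a ≤ m × suc m < 2 ^ suc a × m ≡ suc j + a
nonMersenne₀-position zero = 1 , ≤-refl , ≤-refl , refl
nonMersenne₀-position (suc j) with nonMersenne₀-position j
... | a , lo , hi , m≡ with m≤n⇒m<n∨m≡n hi
...   | inj₁ 2+m<2^[1+a] = a
        , subst (λ x → 2 ^ a ≤ x × suc x < 2 ^ suc a × x ≡ suc (suc j) + a) next
            (m≤n⇒m≤1+n lo , 2+m<2^[1+a] , cong suc m≡)
  where
  next : suc (nonMersenne₀ j) ≡ nonMersenne₀ (suc j)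
  next = IsLeast-unique
    ((≤-refl , between⇒nonMersenne {a} (m≤n⇒m≤1+n lo) 2+m<2^[1+a]) , λ _ → proj₁)
    (proj₂ (nextNonMersenne (nonMersenne₀ j)))
-- Now `suc m` is the Mersenne number `2 ^ suc a ∸ 1`, so the next value is `2 ^ suc a`.
...   | inj₂ 2+m≡2^[1+a] = suc a
        , subst (λ x → 2 ^ suc a ≤ x × suc x < 2 ^ suc (suc a) × x ≡ suc (suc j) + suc a) next
            (lo′ , hi′ , cong suc (trans (cong suc m≡) (sym (+-suc (suc j) a))))
  where
  N = nonMersenne₀ j

  lo′ : 2 ^ suc a ≤ suc (suc N)
  lo′ = ≤-reflexive (sym 2+m≡2^[1+a])

  hi′ : suc (suc (suc N)) < 2 ^ suc (suc a)
  hi′ = subst (λ x → suc x < 2 ^ suc (suc a)) (sym 2+m≡2^[1+a])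
    (subst (suc (2 ^ suc a) <_) (cong (2 ^ suc a +_) (sym (+-identityʳ (2 ^ suc a))))
      (+-monoˡ-< (2 ^ suc a) (≤-trans (s≤s (s≤s z≤n)) hi)))

  1+m-mersenne : Mersenne (suc N)
  1+m-mersenne = suc a , s≤s z≤n , cong (_∸ 1) 2+m≡2^[1+a]

  next : suc (suc N) ≡ nonMersenne₀ (suc j)
  next = IsLeast-unique
    ((m≤n⇒m≤1+n ≤-refl , between⇒nonMersenne {suc a} lo′ hi′) , λ n (m<n , _ , ¬n) →
      ≤∧≢⇒< m<n λ where refl → ¬n 1+m-mersenne)
    (proj₂ (nextNonMersenne N))

2^a≤k+a⇒a≤1+⌊log₂k⌋ : ∀ k a .{{_ : NonZero k}} → 2 ^ a ≤ k + a → a ≤ 1 + ⌊log₂ k ⌋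
2^a≤k+a⇒a≤1+⌊log₂k⌋ k a p = begin
  a                 ≡⟨ ⌊log₂[2^n]⌋≡n a ⟨
  ⌊log₂ (2 ^ a) ⌋   ≤⟨ ⌊log₂⌋-mono-≤ 2^a≤2*k ⟩
  ⌊log₂ (2 * k) ⌋   ≡⟨ ⌊log₂[2*b]⌋≡1+⌊log₂b⌋ k ⟩
  1 + ⌊log₂ k ⌋     ∎
  where
  open ≤-Reasoning
  2^a≤2*k : 2 ^ a ≤ 2 * k
  2^a≤2*k = +-cancelʳ-≤ (2 ^ a) (2 ^ a) (2 * k) (begin
    2 ^ a + 2 ^ a  ≡⟨ cong (2 ^ a +_) (+-identityʳ (2 ^ a)) ⟨
    -- Doubling turns the summand `a` into `2 * a`, which one of the two copies of `2 ^ a` absorbs.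
    2 * 2 ^ a      ≤⟨ *-monoʳ-≤ 2 p ⟩
    2 * (k + a)    ≡⟨ *-distribˡ-+ 2 k a ⟩
    2 * k + 2 * a  ≤⟨ +-monoʳ-≤ (2 * k) (2*n≤2^n a) ⟩
    2 * k + 2 ^ a  ∎)

theorem6p1 : ∀ (k : ℕ) .{{_ : NonZero k}} →
    S₂ k ≤ nM k × nM k ≤ k + 1 + ⌊log₂ k ⌋
theorem6p1 k@(suc j) with nonMersenne₀-position j
... | a , lo , hi , m≡k+a = proj₂ (S₂-isLeast k) N 2^k∣m! , upper
  where
  N = nonMersenne₀ j

  2^k∣m! : 2 ^ k ∣ N !
  -- As `N` is `a + k`, the power `2 ^ N` splits as `2 ^ a * 2 ^ k`.
  2^k∣m! = *-cancelˡ-∣ (2 ^ a) {{m^n≢0 2 a}}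
    (subst (_∣ 2 ^ a * N !)
      (trans (cong (2 ^_) (trans m≡k+a (+-comm k a))) (^-distribˡ-+-* 2 a k))
      (1+m<2^[1+a]⇒2^m∣2^a*m! a N hi))

  open ≤-Reasoning
  upper : N ≤ k + 1 + ⌊log₂ k ⌋
  upper = begin
    N                      ≡⟨ m≡k+a ⟩
    k + a                  ≤⟨ +-monoʳ-≤ k (2^a≤k+a⇒a≤1+⌊log₂k⌋ k a (subst (2 ^ a ≤_) m≡k+a lo)) ⟩
    k + (1 + ⌊log₂ k ⌋)    ≡⟨ +-assoc k 1 ⌊log₂ k ⌋ ⟨
    k + 1 + ⌊log₂ k ⌋      ∎
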